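{- Let $n,d\ge 2$ and let $\mathcal{I}$ be a partial $3$-$(n^d+1,n+1,1)$-design. Suppose that for every point $P$ of $\mathcal{I}$, the derived structure $\mathcal{I}_P$ can be uniquely extended to a full $2$-$(n^d,n,1)$-design $\mathcal{I}'_P$, and that in $\mathcal{I}'_P$ one of the following holds: (i) every added line in $\mathcal{I}'_P$ contains at least $\sqrt n$ simple points, and through every point of $\mathcal{I}'_P$ there are at most $\sqrt n$ added lines of $\mathcal{I}'_P$; or (ii) there is at most one point in $\mathcal{I}'_P$ with more than one added line of $\mathcal{I}'_P$ through it. Then $\mathcal{I}$ can be uniquely completed to a full $3$-$(n^d+1,n+1,1)$-design.
   Context: A $t$-$(v,k,\lambda)$-design (respectively partial $t$-$(v,k,\lambda)$-design) is an incidence structure consisting of a set of $v$ points and a set of $k$-element subsets of points (blocks) such that every set of $t$ points lies in exactly (respectively at most) $\lambda$ blocks. For $t=2$ blocks are called lines; for $t=3$ blocks are called circles. A partial design can be completed (extended) to a full design if there is a full design with the same parameters on the same point set whose block set contains the given block set; uniquely, if there is exactly one such full design. For a partial $3$-$(n^d+1,n+1,1)$-design $\mathcal{I}$ and a point $P$, the derived structure $\mathcal{I}_P$ has as points the points of $\mathcal{I}$ different from $P$, and as lines the sets $C\setminus\{P\}$ for circles $C$ of $\mathcal{I}$ containing $P$; it is a partial $2$-$(n^d,n,1)$-design. If $\mathcal{I}_P$ is extended to a full $2$-$(n^d,n,1)$-design $\mathcal{I}'_P$, an added line is a line of $\mathcal{I}'_P$ that is not a line of $\mathcal{I}_P$.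 A point of $\mathcal{I}'_P$ is simple if exactly one added line of $\mathcal{I}'_P$ passes through it, i.e. if it lies on exactly $\frac{n^d-1}{n-1}-1$ lines of $\mathcal{I}_P$. -}

module Defs where

open import Data.Bool.Properties using () renaming (_≟_ to _≟ᵇ_)
open import Data.Fin.Base using (Fin)
open import Data.Fin.Subset using (Subset; _∈_; _⊆_; _∩_; _-_; ∣_∣)
open import Data.Fin.Subset.Properties using (_∈?_; _⊆?_)
open import Data.List.Base using (List; length; filter; map)
import Data.List.Membership.DecPropositional as DecMembership
open import Data.List.Relation.Binary.BagAndSetEquality using (_∼[_]_; set)
import Data.List.Relation.Binary.Subset.Propositional as ListSubset
open import Data.List.Relation.Unary.All using (All)
open import Data.List.Relation.Unary.Unique.Propositional using (Unique)
open import Data.Nat.Base using (ℕ; _≤_; _<_; _^_)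
open import Data.Nat.Properties using () renaming (_≟_ to _≟ⁿ_)
open import Data.Vec.Base using (tabulate)
open import Data.Vec.Properties using (≡-dec)
open import Relation.Binary.Definitions using (DecidableEquality)
open import Relation.Binary.PropositionalEquality.Core using (_≡_)
open import Relation.Nullary.Decidable.Core using (does; ¬?)

private
  variable
    u : ℕ

-- Points are taken from an ambient finite set Fin u, so that the derived
-- structure at a point literally has the remaining points as its points.
record IncidenceStructure (u : ℕ) : Set where
  constructor mkIncidence
  field
    points : Subset u
    blocks : List (Subset u)

open IncidenceStructure public

numBlocksThrough : Subset u → List (Subset u) → ℕ
numBlocksThrough T B = length (filter (T ⊆?_) B)

-- Uniqueness makes the list of blocks represent a set, whose elements are
-- then counted correctly by numBlocksThrough.
record IsBlockSystem (v k : ℕ) (I : IncidenceStructure u) : Set where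
  field
    numPoints     : ∣ points I ∣ ≡ v
    blocksUnique  : Unique (blocks I)
    blocks⊆points : All (_⊆ points I) (blocks I)
    blockSize     : All (λ C → ∣ C ∣ ≡ k) (blocks I)

record IsPartialDesign (t v k l : ℕ) (I : IncidenceStructure u) : Set where
  field
    isBlockSystem : IsBlockSystem v k I
    atMost : ∀ T → T ⊆ points I → ∣ T ∣ ≡ t → numBlocksThrough T (blocks I) ≤ l

record IsDesign (t v k l : ℕ) (I : IncidenceStructure u) : Set where
  field
    isBlockSystem : IsBlockSystem v k I
    exactly : ∀ T → T ⊆ points I → ∣ T ∣ ≡ t → numBlocksThrough T (blocks I) ≡ l

record IsCompletion (t v k l : ℕ) (I D : IncidenceStructure u) : Set where
  field
    isDesign    : IsDesign t v k l D
    samePoints  : points D ≡ points I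
    blocks⊆     : blocks I ListSubset.⊆ blocks D

-- Designs are identified when they have the same set of blocks, regardless
-- of the order in which the blocks are listed.
record IsUniqueCompletion (t v k l : ℕ) (I D : IncidenceStructure u) : Set where
  field
    isCompletion : IsCompletion t v k l I D
    unique : ∀ D′ → IsCompletion t v k l I D′ → blocks D′ ∼[ set ] blocks D

derived : IncidenceStructure u → Fin u → IncidenceStructure u
derived I P = mkIncidence (points I - P) (map (_- P) (filter (P ∈?_) (blocks I)))

_≟ˢ_ : DecidableEquality (Subset u)
_≟ˢ_ = ≡-dec _≟ᵇ_

-- In the following, D is an extension of J.

addedLines : (J D : IncidenceStructure u) → List (Subset u)
addedLines J D = filter (λ L → ¬? (L ∈ˡ? blocks J)) (blocks D)
  where open DecMembership _≟ˢ_ using () renaming (_∈?_ to _∈ˡ?_)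

numAddedThrough : (J D : IncidenceStructure u) → Fin u → ℕ
numAddedThrough J D Q = length (filter (Q ∈?_) (addedLines J D))

simplePoints : (J D : IncidenceStructure u) → Subset u
simplePoints J D = points D ∩ tabulate (λ Q → does (numAddedThrough J D Q ≟ⁿ 1))

-- For natural numbers, m ≥ √n means n ≤ m ^ 2 and m ≤ √n means m ^ 2 ≤ n.
record ManySimpleFewAdded (n : ℕ) (J D : IncidenceStructure u) : Set where
  field
    manySimple : All (λ L → n ≤ ∣ L ∩ simplePoints J D ∣ ^ 2) (addedLines J D)
    fewAdded   : ∀ Q → Q ∈ points D → numAddedThrough J D Q ^ 2 ≤ n

AtMostOneMultiplyAdded : (J D : IncidenceStructure u) → Set
AtMostOneMultiplyAdded J D =
  ∀ Q R → Q ∈ points D → R ∈ points D →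
  1 < numAddedThrough J D Q → 1 < numAddedThrough J D R → Q ≡ R

{-# OPTIONS --safe #-}

-- The circles of the completion are the sets L ∪ {P} with L a line of the extension D P of the
-- derived structure at P. The point is that L ∪ {P} does not depend on the choice of P: if L is
-- an added line of D P and Q ∈ L, then C = (L ∪ {P}) - Q is an added line of D Q.
-- Call a triple uncovered if no given circle contains it; a line of D P is added iff {P} together
-- with two of its points is uncovered. If Q is simple in D P, the points x with {P, Q, x} uncovered
-- are those of L - Q, so the claim holds. In particular, for every simple y ∈ L all triples in
-- L ∪ {P} containing y are uncovered, so in D Q the point y is joined to all of C by added lines,
-- and so is P. There are more than √n such points, and a pigeonhole argument in D Q (or a simple
-- one among these points, if D Q satisfies (ii)) forces C to be a line.
module Submission where

open import Defs
open import Data.Fin.Base using (Fin; zero; suc)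
import Data.Fin.Properties as Fin
open import Data.Fin.Subset using
  (Subset; _∈_; _∉_; _⊆_; _∩_; _∪_; _─_; _-_; ∣_∣; ⁅_⁆; Nonempty; inside; outside)
open import Data.Fin.Subset.Properties
open import Data.List.Base using
  (List; []; _∷_; length; filter; map; concatMap; deduplicate; allFin)
import Data.List.Membership.DecPropositional as DecMembership
open import Data.List.Membership.Propositional using (find; lose) renaming (_∈_ to _∈ˡ_)
open import Data.List.Membership.Propositional.Properties using
  (∈-filter⁺; ∈-filter⁻; ∈-map⁺; ∈-map⁻; ∈-concatMap⁺; ∈-concatMap⁻; ∈-deduplicate⁺; ∈-deduplicate⁻; ∈-allFin)
open import Data.List.Relation.Binary.BagAndSetEquality using (_∼[_]_; set)
open import Data.List.Relation.Unary.All as All using ([]; _∷_)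
open import Data.List.Relation.Unary.AllPairs using ([]; _∷_)
open import Data.List.Relation.Unary.Any as Any using (here; there)
import Data.List.Relation.Unary.Unique.DecPropositional.Properties as DecUnique
open import Data.List.Relation.Unary.Unique.Propositional using (Unique)
import Data.List.Relation.Unary.Unique.Propositional.Properties as Unique
open import Data.Nat.Base using (ℕ; zero; suc; _≤_; _<_; _+_; _*_; _^_; z≤n; s≤s; >-nonZero)
open import Data.Nat.Properties
open import Data.Product.Base using (∃; _×_; _,_; proj₁; proj₂)
open import Data.Sum.Base using (_⊎_; inj₁; inj₂)
open import Data.Vec.Base using ([]; _∷_; here; there)
open import Data.Vec.Properties using (lookup∘tabulate; lookup⇒[]=; []=⇒lookup)
open import Function.Bundles using (Equivalence; mk⇔)
open import Level using (0ℓ)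
open import Relation.Binary.PropositionalEquality
open import Relation.Nullary using (¬_; yes; no; contradiction)
open import Relation.Nullary.Decidable using (¬?; dec-true; dec-false)
open import Relation.Unary using (Pred; Decidable)

private
  variable
    u : ℕ
    p q : Subset u
    x y : Fin u

-- Finite subsets: removing and adjoining a point, cardinalities.

x∈p─q⇒x∉q : ∀ (p q : Subset u) → x ∈ p ─ q → x ∉ q
x∈p─q⇒x∉q (_ ∷ p) (inside ∷ q) () here
x∈p─q⇒x∉q (_ ∷ p) (_ ∷ q) (there x∈) (there x∈q) = x∈p─q⇒x∉q p q x∈ x∈q

x∈p-y⇒x∈p : ∀ (p : Subset u) y → x ∈ p - y → x ∈ p
x∈p-y⇒x∈p p y = p─q⊆p p ⁅ y ⁆

x∈p-y⇒x≢y : ∀ (p : Subset u) y → x ∈ p - y → x ≢ y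
x∈p-y⇒x≢y p y x∈ = x∉⁅y⁆⇒x≢y (x∈p─q⇒x∉q p ⁅ y ⁆ x∈)

∣p∣≡1+∣p-x∣ : ∀ (p : Subset u) → x ∈ p → ∣ p ∣ ≡ suc ∣ p - x ∣
∣p∣≡1+∣p-x∣ (inside ∷ p) here = cong (λ q → suc ∣ q ∣) (sym (p─⊥≡p p))
∣p∣≡1+∣p-x∣ (inside ∷ p) (there x∈p) = cong suc (∣p∣≡1+∣p-x∣ p x∈p)
∣p∣≡1+∣p-x∣ (outside ∷ p) (there x∈p) = ∣p∣≡1+∣p-x∣ p x∈p

p-x∪x≡p : x ∈ p → (p - x) ∪ ⁅ x ⁆ ≡ p
p-x∪x≡p {x = x} {p = p} x∈p = ⊆-antisym to from
  where
  to : (p - x) ∪ ⁅ x ⁆ ⊆ p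
  to y∈ with x∈p∪q⁻ (p - x) ⁅ x ⁆ y∈
  ... | inj₁ y∈p-x = x∈p-y⇒x∈p p x y∈p-x
  ... | inj₂ y∈x = subst (_∈ p) (sym (x∈⁅y⁆⇒x≡y x y∈x)) x∈p
  from : p ⊆ (p - x) ∪ ⁅ x ⁆
  from {y} y∈p with y Fin.≟ x
  ... | yes refl = x∈p∪q⁺ (inj₂ (x∈⁅x⁆ x))
  ... | no y≢x = x∈p∪q⁺ (inj₁ (x∈p∧x≢y⇒x∈p-y y∈p y≢x))

p∪x-x≡p : x ∉ p → (p ∪ ⁅ x ⁆) - x ≡ p
p∪x-x≡p {x = x} {p = p} x∉p = ⊆-antisym to from
  where
  to : (p ∪ ⁅ x ⁆) - x ⊆ p
  to y∈ with x∈p∪q⁻ p ⁅ x ⁆ (x∈p-y⇒x∈p (p ∪ ⁅ x ⁆) x y∈)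
  ... | inj₁ y∈p = y∈p
  ... | inj₂ y∈x = contradiction (x∈⁅y⁆⇒x≡y x y∈x) (x∈p-y⇒x≢y (p ∪ ⁅ x ⁆) x y∈)
  from : p ⊆ (p ∪ ⁅ x ⁆) - x
  from y∈p = x∈p∧x≢y⇒x∈p-y (x∈p∪q⁺ (inj₁ y∈p)) (λ where refl → x∉p y∈p)

p-x≡q-x⇒p≡q : x ∈ p → x ∈ q → p - x ≡ q - x → p ≡ q
p-x≡q-x⇒p≡q {x = x} x∈p x∈q eq = trans (sym (p-x∪x≡p x∈p)) (trans (cong (_∪ ⁅ x ⁆) eq) (p-x∪x≡p x∈q))

p-x⊆q⇒p⊆q : x ∈ q → p - x ⊆ q → p ⊆ q
p-x⊆q⇒p⊆q {x = x} x∈q p-x⊆q {y} y∈p with y Fin.≟ x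
... | yes refl = x∈q
... | no y≢x = p-x⊆q (x∈p∧x≢y⇒x∈p-y y∈p y≢x)

p⊆q⇒p-x⊆q-x : p ⊆ q → p - x ⊆ q - x
p⊆q⇒p-x⊆q-x {p = p} {x = x} p⊆q y∈ = x∈p∧x≢y⇒x∈p-y (p⊆q (x∈p-y⇒x∈p p x y∈)) (x∈p-y⇒x≢y p x y∈)

singleton⊆ : x ∈ p → ⁅ x ⁆ ⊆ p
singleton⊆ {x = x} {p = p} x∈p y∈x = subst (_∈ p) (sym (x∈⁅y⁆⇒x≡y x y∈x)) x∈p

x∈p∪⁅x⁆ : ∀ (p : Subset u) x → x ∈ p ∪ ⁅ x ⁆
x∈p∪⁅x⁆ p x = x∈p∪q⁺ (inj₂ (x∈⁅x⁆ x))

p⊆q⇒p∪x⊆q : p ⊆ q → x ∈ q → p ∪ ⁅ x ⁆ ⊆ q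
p⊆q⇒p∪x⊆q {p = p} {q = q} {x = x} p⊆q x∈q y∈ with x∈p∪q⁻ p ⁅ x ⁆ y∈
... | inj₁ y∈p = p⊆q y∈p
... | inj₂ y∈x = subst (_∈ q) (sym (x∈⁅y⁆⇒x≡y x y∈x)) x∈q

∣p∪x∣≡1+∣p∣ : ∀ (p : Subset u) → x ∉ p → ∣ p ∪ ⁅ x ⁆ ∣ ≡ suc ∣ p ∣
∣p∪x∣≡1+∣p∣ {x = x} p x∉p =
  trans (∣p∣≡1+∣p-x∣ _ (x∈p∪⁅x⁆ p x)) (cong (λ q → suc ∣ q ∣) (p∪x-x≡p x∉p))

p⊆q∧∣q∣≤∣p∣⇒p≡q : p ⊆ q → ∣ q ∣ ≤ ∣ p ∣ → p ≡ q
p⊆q∧∣q∣≤∣p∣⇒p≡q {p = p} {q = q} p⊆q q≤p = ⊆-antisym p⊆q q⊆p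
  where
  q⊆p : q ⊆ p
  q⊆p {x} x∈q with x ∈? p
  ... | yes x∈p = x∈p
  ... | no x∉p = contradiction
    (p⊆q⇒∣p∣≤∣q∣ {p = p} {q = q - x} λ y∈p → x∈p∧x≢y⇒x∈p-y (p⊆q y∈p) λ where refl → x∉p y∈p)
    (<⇒≱ (<-≤-trans (x∈p⇒∣p-x∣<∣p∣ x∈q) q≤p))

0<∣p∣⇒Nonempty : ∀ (p : Subset u) → 0 < ∣ p ∣ → Nonempty p
0<∣p∣⇒Nonempty {u} p 0<p with nonempty? p
... | yes ne = ne
... | no empty = contradiction (trans (cong ∣_∣ (Empty-unique empty)) (∣⊥∣≡0 u)) (>⇒≢ 0<p)

1<∣p∣⇒another : ∀ (p : Subset u) → 1 < ∣ p ∣ → x ∈ p → ∃ λ y → y ∈ p × y ≢ x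
1<∣p∣⇒another {x = x} p 1<p x∈p
  with y , y∈ ← 0<∣p∣⇒Nonempty (p - x) (≤-pred (subst (1 <_) (∣p∣≡1+∣p-x∣ p x∈p) 1<p))
  = y , x∈p-y⇒x∈p p x y∈ , x∈p-y⇒x≢y p x y∈

∣p∣≤1 : ∀ (p : Subset u) → (∀ {x y} → x ∈ p → y ∈ p → x ≡ y) → ∣ p ∣ ≤ 1
∣p∣≤1 p eq = ≮⇒≥ λ 1<p →
  let x , x∈p = 0<∣p∣⇒Nonempty p (<-trans (n<1+n 0) 1<p)
      y , y∈p , y≢x = 1<∣p∣⇒another p 1<p x∈p
  in y≢x (eq y∈p x∈p)

∣p∣≡∣p∩q∣+∣p─q∣ : ∀ (p q : Subset u) → ∣ p ∣ ≡ ∣ p ∩ q ∣ + ∣ p ─ q ∣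
∣p∣≡∣p∩q∣+∣p─q∣ [] [] = refl
∣p∣≡∣p∩q∣+∣p─q∣ (inside ∷ p) (inside ∷ q) = cong suc (∣p∣≡∣p∩q∣+∣p─q∣ p q)
∣p∣≡∣p∩q∣+∣p─q∣ (inside ∷ p) (outside ∷ q) =
  trans (cong suc (∣p∣≡∣p∩q∣+∣p─q∣ p q)) (sym (+-suc ∣ p ∩ q ∣ ∣ p ─ q ∣))
∣p∣≡∣p∩q∣+∣p─q∣ (outside ∷ p) (inside ∷ q) = ∣p∣≡∣p∩q∣+∣p─q∣ p q
∣p∣≡∣p∩q∣+∣p─q∣ (outside ∷ p) (outside ∷ q) = ∣p∣≡∣p∩q∣+∣p─q∣ p q

-- Peel off one covering set at a time: `K` accounts for at most `b` elements of `p`, and the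
-- remaining sets still cover `p ─ K`. This is the pigeonhole principle behind all the counting
-- below.
cover-bound : ∀ b (Ls : List (Subset u)) (p : Subset u) →
  (∀ {x} → x ∈ p → ∃ λ L → L ∈ˡ Ls × x ∈ L) →
  (∀ {L} → L ∈ˡ Ls → ∣ p ∩ L ∣ ≤ b) → ∣ p ∣ ≤ length Ls * b
cover-bound b [] p cover bound = ≮⇒≥ λ 0<p →
  let x , x∈p = 0<∣p∣⇒Nonempty p 0<p
      _ , L∈[] , _ = cover x∈p
  in contradiction L∈[] λ ()
cover-bound b (K ∷ Ls) p cover bound = begin
  ∣ p ∣                   ≡⟨ ∣p∣≡∣p∩q∣+∣p─q∣ p K ⟩
  ∣ p ∩ K ∣ + ∣ p ─ K ∣   ≤⟨ +-mono-≤ (bound (here refl)) (cover-bound b Ls (p ─ K) cover′ bound′) ⟩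
  b + length Ls * b       ∎
  where
  open ≤-Reasoning
  cover′ : ∀ {x} → x ∈ p ─ K → ∃ λ L → L ∈ˡ Ls × x ∈ L
  cover′ x∈ with cover (p─q⊆p p K x∈)
  ... | L , here refl , x∈L = contradiction x∈L (x∈p─q⇒x∉q p K x∈)
  ... | L , there L∈ , x∈L = L , L∈ , x∈L
  bound′ : ∀ {L} → L ∈ˡ Ls → ∣ (p ─ K) ∩ L ∣ ≤ b
  bound′ {L} L∈ = ≤-trans
    (p⊆q⇒∣p∣≤∣q∣ λ x∈ → let x∈p─K , x∈L = x∈p∩q⁻ (p ─ K) L x∈ in x∈p∩q⁺ (p─q⊆p p K x∈p─K , x∈L))
    (bound (there L∈))

-- Lists without repetition and filters with a single hit.

module _ {A : Set} where

  length≤1⇒≡ : ∀ {xs : List A} {x y} → length xs ≤ 1 → x ∈ˡ xs → y ∈ˡ xs → x ≡ y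
  length≤1⇒≡ {_ ∷ []} _ (here refl) (here refl) = refl
  length≤1⇒≡ {_ ∷ _ ∷ _} (s≤s ()) _ _

  ∈⇒0<length : ∀ {xs : List A} {x} → x ∈ˡ xs → 0 < length xs
  ∈⇒0<length (here _) = s≤s z≤n
  ∈⇒0<length (there _) = s≤s z≤n

  -- Injectivity is asked for on the members of the list only, because `_- P` is injective on blocks
  -- that contain `P` but not on all subsets.
  Unique-map : ∀ {B : Set} {f : A → B} {xs : List A} →
    (∀ {x y} → x ∈ˡ xs → y ∈ˡ xs → f x ≡ f y → x ≡ y) → Unique xs → Unique (map f xs)
  Unique-map inj [] = []
  Unique-map {f = f} inj (x∉xs ∷ uniq) =
    All.tabulate (λ fy∈ fx≡fy → let y , y∈xs , eq = ∈-map⁻ f fy∈ in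
      All.lookup x∉xs y∈xs (inj (here refl) (there y∈xs) (trans fx≡fy eq)))
    ∷ Unique-map (λ x∈ y∈ → inj (there x∈) (there y∈)) uniq

  0<length⇒∈ : ∀ {xs : List A} → 0 < length xs → ∃ λ x → x ∈ˡ xs
  0<length⇒∈ {x ∷ _} _ = x , here refl

  Unique∧≡⇒length≤1 : ∀ {xs : List A} → Unique xs → (∀ {x y} → x ∈ˡ xs → y ∈ˡ xs → x ≡ y) → length xs ≤ 1
  Unique∧≡⇒length≤1 {[]} _ _ = z≤n
  Unique∧≡⇒length≤1 {_ ∷ []} _ _ = s≤s z≤n
  Unique∧≡⇒length≤1 {_ ∷ _ ∷ _} ((x≢y ∷ _) ∷ _) eq = contradiction (eq (here refl) (there (here refl))) x≢y

  module _ {P : Pred A 0ℓ} (P? : Decidable P) {xs : List A} where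

    -- Turns the counting axiom of a design with λ = 1 into existence and uniqueness of a block;
    -- `length-filter≡1⁺` goes back.
    length-filter≡1⁻ : length (filter P? xs) ≡ 1 →
      ∃ λ x → x ∈ˡ xs × P x × (∀ {y} → y ∈ˡ xs → P y → y ≡ x)
    length-filter≡1⁻ eq
      with x , x∈ ← 0<length⇒∈ (≤-reflexive (sym eq))
      with x∈xs , Px ← ∈-filter⁻ P? x∈
      = x , x∈xs , Px , λ y∈xs Py → length≤1⇒≡ (≤-reflexive eq) (∈-filter⁺ P? y∈xs Py) x∈

    length-filter≡1⁺ : Unique xs → ∀ {x} → x ∈ˡ xs → P x →
      (∀ {y} → y ∈ˡ xs → P y → y ≡ x) → length (filter P? xs) ≡ 1
    length-filter≡1⁺ uniq x∈xs Px only = ≤-antisym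
      (Unique∧≡⇒length≤1 (Unique.filter⁺ P? uniq) λ y∈ z∈ → trans (only′ y∈) (sym (only′ z∈)))
      (∈⇒0<length (∈-filter⁺ P? x∈xs Px))
      where
      only′ : ∀ {y} → y ∈ˡ filter P? xs → y ≡ _
      only′ y∈ = let y∈xs , Py = ∈-filter⁻ P? y∈ in only y∈xs Py

    length-filter≤1⇒≡ : length (filter P? xs) ≤ 1 → ∀ {x y} → x ∈ˡ xs → P x → y ∈ˡ xs → P y → x ≡ y
    length-filter≤1⇒≡ le x∈ Px y∈ Py = length≤1⇒≡ le (∈-filter⁺ P? x∈ Px) (∈-filter⁺ P? y∈ Py)

-- Integer square roots.

isqrt : ∀ n → ∃ λ s → s * s ≤ n × n < suc s * suc s
isqrt zero = 0 , z≤n , s≤s z≤n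
isqrt (suc n) with isqrt n
... | s , s²≤n , n<[1+s]² with suc s * suc s ≤? suc n
...   | yes le = suc s , le , ≤-trans (s≤s n<[1+s]²) (*-mono-< (n<1+n (suc s)) (n<1+n (suc s)))
...   | no nle = s , m≤n⇒m≤1+n s²≤n , ≰⇒> nle

m*m<n*n⇒m<n : ∀ {m n} → m * m < n * n → m < n
m*m<n*n⇒m<n m²<n² = ≰⇒> λ n≤m → <⇒≱ m²<n² (*-mono-≤ n≤m n≤m)

m^2≡m*m : ∀ m → m ^ 2 ≡ m * m
m^2≡m*m m = cong (m *_) (*-identityʳ m)

-- Recognising a line in a partial linear space.

module Lines {u} (A : List (Subset u)) (n : ℕ) (2≤n : 2 ≤ n)
  (size : ∀ {L} → L ∈ˡ A → ∣ L ∣ ≡ n)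
  (meet : ∀ {L M y z} → L ∈ˡ A → M ∈ˡ A → y ≢ z → y ∈ L → z ∈ L → y ∈ M → z ∈ M → L ≡ M) where

  degree : Fin u → ℕ
  degree y = length (filter (y ∈?_) A)

  Joined : Fin u → Fin u → Set
  Joined y x = ∃ λ L → L ∈ˡ A × y ∈ L × x ∈ L

  joined-bound : ∀ b y (T : Subset u) → (∀ {x} → x ∈ T → Joined y x) →
    (∀ {L} → L ∈ˡ A → y ∈ L → ∣ T ∩ L ∣ ≤ b) → ∣ T ∣ ≤ degree y * b
  joined-bound b y T joined bound = cover-bound b (filter (y ∈?_) A) T
    (λ x∈T → let L , L∈A , y∈L , x∈L = joined x∈T in L , ∈-filter⁺ (y ∈?_) L∈A y∈L , x∈L)
    (λ L∈ → let L∈A , y∈L = ∈-filter⁻ (y ∈?_) L∈ in bound L∈A y∈L)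

  -- A line through `y` differs from `K`, so it meets `K` in at most one point. Distinct points of
  -- `T` therefore need distinct lines through `y`.
  off-line-bound : ∀ {K y} (T : Subset u) → K ∈ˡ A → y ∉ K → T ⊆ K →
    (∀ {x} → x ∈ T → Joined y x) → ∣ T ∣ ≤ degree y
  off-line-bound {K} {y} T K∈A y∉K T⊆K joined =
    subst (∣ T ∣ ≤_) (*-identityʳ (degree y)) (joined-bound 1 y T joined bound)
    where
    bound : ∀ {L} → L ∈ˡ A → y ∈ L → ∣ T ∩ L ∣ ≤ 1
    bound {L} L∈A y∈L = ∣p∣≤1 (T ∩ L) same
      where
      same : ∀ {x z} → x ∈ T ∩ L → z ∈ T ∩ L → x ≡ z
      same {x} {z} x∈ z∈ with x Fin.≟ z
      ... | yes x≡z = x≡z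
      ... | no x≢z =
        let x∈T , x∈L = x∈p∩q⁻ T L x∈
            z∈T , z∈L = x∈p∩q⁻ T L z∈
        in contradiction (subst (y ∈_) (meet L∈A K∈A x≢z x∈L z∈L (T⊆K x∈T) (T⊆K z∈T)) y∈L) y∉K

  -- `C` has the size of a line, and the points of `R` are joined to all of `C`. Each result below
  -- derives from this that `C` is itself a line, under a different bound on degrees; by size it is
  -- enough to find a line containing `C`.
  module _ (C R : Subset u) (∣C∣≡n : ∣ C ∣ ≡ n) (R⊆C : R ⊆ C)
    (joined : ∀ {y x} → y ∈ R → x ∈ C → x ≢ y → Joined y x) where

    C⊆K⇒C∈A : ∀ {K} → K ∈ˡ A → C ⊆ K → C ∈ˡ A
    C⊆K⇒C∈A K∈A C⊆K = subst (_∈ˡ A)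
      (sym (p⊆q∧∣q∣≤∣p∣⇒p≡q C⊆K (≤-reflexive (trans (size K∈A) (sym ∣C∣≡n))))) K∈A

    -- All the lines joining `y` to the other points of `C` coincide, so this one line contains `C`.
    C∈A-of-degree≤1 : ∀ {y} → y ∈ R → degree y ≤ 1 → C ∈ˡ A
    C∈A-of-degree≤1 {y} y∈R deg≤1
      with x , x∈C , x≢y ← 1<∣p∣⇒another C (subst (2 ≤_) (sym ∣C∣≡n) 2≤n) (R⊆C y∈R)
      with K , K∈A , y∈K , _ ← joined y∈R x∈C x≢y = C⊆K⇒C∈A K∈A C⊆K
      where
      C⊆K : C ⊆ K
      C⊆K {z} z∈C with z Fin.≟ y
      ... | yes refl = y∈K
      ... | no z≢y with L , L∈A , y∈L , z∈L ← joined y∈R z∈C z≢y =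
        subst (z ∈_) (length-filter≤1⇒≡ (y ∈?_) deg≤1 L∈A y∈L K∈A y∈K) z∈L

    -- Of two points of `R`, at least one has degree at most 1.
    C∈A-of-few-multiple : 1 < ∣ R ∣ →
      (∀ {y z} → y ∈ C → z ∈ C → 1 < degree y → 1 < degree z → y ≡ z) → C ∈ˡ A
    C∈A-of-few-multiple 1<R few
      with y , y∈R ← 0<∣p∣⇒Nonempty R (<-trans (n<1+n 0) 1<R)
      with z , z∈R , z≢y ← 1<∣p∣⇒another R 1<R y∈R
      with degree y ≤? 1 | degree z ≤? 1
    ... | yes y≤1 | _ = C∈A-of-degree≤1 y∈R y≤1
    ... | no _ | yes z≤1 = C∈A-of-degree≤1 z∈R z≤1
    ... | no y≰1 | no z≰1 = contradiction (few (R⊆C z∈R) (R⊆C y∈R) (≰⇒> z≰1) (≰⇒> y≰1)) z≢y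

    -- A line K through y ∈ R with more than s points in C exists by pigeonhole, and a point
    -- off K is joined to at most s points of K; hence R ⊆ K, and then C ⊆ K.
    C∈A-of-bounded : ∀ s → s * s ≤ n → s < ∣ R ∣ → (∀ {y} → y ∈ C → degree y ≤ s) → C ∈ˡ A
    C∈A-of-bounded s s²≤n s<R bounded
      with y , y∈R ← 0<∣p∣⇒Nonempty R (≤-trans (s≤s z≤n) s<R)
      -- The count leaves out `y`, so a line found here has more than `s` points in `C`.
      with Any.any? (λ L → s ≤? ∣ (C - y) ∩ L ∣) (filter (y ∈?_) A)
    ... | yes rich = C⊆K⇒C∈A K∈A C⊆K
      where
      K : Subset u
      K = proj₁ (find rich)
      K∈A : K ∈ˡ A
      K∈A = proj₁ (∈-filter⁻ (y ∈?_) {xs = A} (proj₁ (proj₂ (find rich))))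
      y∈K : y ∈ K
      y∈K = proj₂ (∈-filter⁻ (y ∈?_) {xs = A} (proj₁ (proj₂ (find rich))))
      s<C∩K : s < ∣ C ∩ K ∣
      s<C∩K = ≤-trans (s≤s (proj₂ (proj₂ (find rich)))) (≤-trans
        (s≤s (p⊆q⇒∣p∣≤∣q∣ λ x∈ →
          let x∈C-y , x∈K = x∈p∩q⁻ (C - y) K x∈
          in x∈p∧x≢y⇒x∈p-y (x∈p∩q⁺ (x∈p-y⇒x∈p C y x∈C-y , x∈K)) (x∈p-y⇒x≢y C y x∈C-y)))
        (≤-reflexive (sym (∣p∣≡1+∣p-x∣ (C ∩ K) (x∈p∩q⁺ (R⊆C y∈R , y∈K))))))
      R⊆K : R ⊆ K
      R⊆K {z} z∈R with z ∈? K
      ... | yes z∈K = z∈K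
      ... | no z∉K = contradiction
        (≤-trans (off-line-bound (C ∩ K) K∈A z∉K (p∩q⊆q C K) λ x∈ →
          let x∈C , x∈K = x∈p∩q⁻ C K x∈ in joined z∈R x∈C λ where refl → z∉K x∈K)
          (bounded (R⊆C z∈R)))
        (<⇒≱ s<C∩K)
      C⊆K : C ⊆ K
      C⊆K {z} z∈C with z ∈? K
      ... | yes z∈K = z∈K
      ... | no z∉K = contradiction
        (≤-trans (off-line-bound R K∈A z∉K R⊆K λ x∈R →
          let L , L∈A , x∈L , z∈L = joined x∈R z∈C λ where refl → z∉K (R⊆K x∈R)
          in L , L∈A , z∈L , x∈L)
          (bounded z∈C))
        (<⇒≱ s<R)
    ... | no poor = contradiction (too-small s s²≤n bound) (<⇒≱ 2≤n)
      where
      n≡1+∣C-y∣ : n ≡ suc ∣ C - y ∣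
      n≡1+∣C-y∣ = trans (sym ∣C∣≡n) (∣p∣≡1+∣p-x∣ C (R⊆C y∈R))
      -- Without a rich line, each line through `y` has at most `s - 1` points of `C - y`, so
      -- `n - 1` is at most `s * (s - 1)`. The variable `b` replaces `s - 1` to avoid truncated
      -- subtraction.
      bound : ∀ b → s ≤ suc b → n ≤ suc (s * b)
      bound b s≤1+b = subst (_≤ suc (s * b)) (sym n≡1+∣C-y∣) (s≤s (≤-trans
        (joined-bound b y (C - y)
          (λ x∈ → joined y∈R (x∈p-y⇒x∈p C y x∈) (x∈p-y⇒x≢y C y x∈))
          (λ L∈A y∈L → ≤-pred (<-≤-trans (≰⇒> λ s≤ → poor (lose (∈-filter⁺ (y ∈?_) L∈A y∈L) s≤)) s≤1+b)))
        (*-monoˡ-≤ b (bounded (R⊆C y∈R)))))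
      -- For `s = suc b`, the bounds `s * s ≤ n ≤ 1 + s * b` give `s ≤ 1`, hence `b = 0` and
      -- `n ≤ 1`.
      too-small : ∀ s → s * s ≤ n → (∀ b → s ≤ suc b → n ≤ suc (s * b)) → n ≤ 1
      too-small zero _ bd = bd 0 z≤n
      too-small (suc b) s²≤n bd = ≤-trans (bd b ≤-refl) (s≤s (≤-reflexive (trans (cong (suc b *_) b≡0) (*-zeroʳ (suc b)))))
        where
        b≡0 : b ≡ 0
        b≡0 = n≤0⇒n≡0 (≤-pred (+-cancelʳ-≤ (suc b * b) (suc b) 1
          (subst (_≤ suc (suc b * b)) (*-suc (suc b) b) (≤-trans s²≤n (bd b ≤-refl)))))

-- Lines of a 2-design.

module Design {u v k} {D : IncidenceStructure u} (design : IsDesign 2 v k 1 D) where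
  open IsDesign design
  open IsBlockSystem isBlockSystem

  line⊆points : ∀ {L} → L ∈ˡ blocks D → L ⊆ points D
  line⊆points = All.lookup blocks⊆points

  line-size : ∀ {L} → L ∈ˡ blocks D → ∣ L ∣ ≡ k
  line-size = All.lookup blockSize

  unique-line : ∀ {y z} → y ≢ z → y ∈ points D → z ∈ points D →
    ∃ λ L → L ∈ˡ blocks D × (⁅ y ⁆ ∪ ⁅ z ⁆) ⊆ L ×
      (∀ {M} → M ∈ˡ blocks D → (⁅ y ⁆ ∪ ⁅ z ⁆) ⊆ M → M ≡ L)
  unique-line {y} {z} y≢z y∈ z∈ = length-filter≡1⁻ ((⁅ y ⁆ ∪ ⁅ z ⁆) ⊆?_)
    (exactly (⁅ y ⁆ ∪ ⁅ z ⁆) (p⊆q⇒p∪x⊆q (singleton⊆ y∈) z∈)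
      (trans (∣p∪x∣≡1+∣p∣ ⁅ y ⁆ λ z∈y → y≢z (sym (x∈⁅y⁆⇒x≡y y z∈y))) (cong suc (∣⁅x⁆∣≡1 y))))

  line-through : ∀ {y z} → y ≢ z → y ∈ points D → z ∈ points D →
    ∃ λ L → L ∈ˡ blocks D × y ∈ L × z ∈ L
  line-through {y} {z} y≢z y∈ z∈ =
    let L , L∈D , yz⊆L , _ = unique-line y≢z y∈ z∈
    in L , L∈D , yz⊆L (x∈p∪q⁺ (inj₁ (x∈⁅x⁆ y))) , yz⊆L (x∈p∪⁅x⁆ ⁅ y ⁆ z)

  line-unique : ∀ {L M y z} → L ∈ˡ blocks D → M ∈ˡ blocks D →
    y ≢ z → y ∈ L → z ∈ L → y ∈ M → z ∈ M → L ≡ M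
  line-unique L∈D M∈D y≢z y∈L z∈L y∈M z∈M =
    let _ , _ , _ , only = unique-line y≢z (line⊆points L∈D y∈L) (line⊆points L∈D z∈L)
    in trans (only L∈D (p⊆q⇒p∪x⊆q (singleton⊆ y∈L) z∈L)) (sym (only M∈D (p⊆q⇒p∪x⊆q (singleton⊆ y∈M) z∈M)))

-- Simple points and derived structures.

∈simplePoints⁺ : ∀ (J D : IncidenceStructure u) {y} → y ∈ points D → numAddedThrough J D y ≡ 1 → y ∈ simplePoints J D
∈simplePoints⁺ J D {y} y∈D simple = x∈p∩q⁺ (y∈D , lookup⇒[]= y _
  (trans (lookup∘tabulate _ y) (dec-true (numAddedThrough J D y ≟ 1) simple)))

∈simplePoints⁻ : ∀ (J D : IncidenceStructure u) {y} → y ∈ simplePoints J D → numAddedThrough J D y ≡ 1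
∈simplePoints⁻ J D {y} y∈ with numAddedThrough J D y ≟ 1
... | yes simple = simple
... | no nonsimple = contradiction
  (trans (sym (trans (lookup∘tabulate _ y) (dec-false (numAddedThrough J D y ≟ 1) nonsimple)))
    ([]=⇒lookup (proj₂ (x∈p∩q⁻ (points D) _ y∈))))
  (λ ())

∈derived⁺ : ∀ (I : IncidenceStructure u) {P C} → C ∈ˡ blocks I → P ∈ C → (C - P) ∈ˡ blocks (derived I P)
∈derived⁺ I {P} C∈I P∈C = ∈-map⁺ (_- P) (∈-filter⁺ (P ∈?_) C∈I P∈C)

∈derived⁻ : ∀ (I : IncidenceStructure u) {P L} → L ∈ˡ blocks (derived I P) → ∃ λ C → C ∈ˡ blocks I × P ∈ C × L ≡ C - P
∈derived⁻ I {P} L∈ =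
  let C , C∈ , L≡C-P = ∈-map⁻ (_- P) L∈
      C∈I , P∈C = ∈-filter⁻ (P ∈?_) {xs = blocks I} C∈
  in C , C∈I , P∈C , L≡C-P

-- Removing `P` is a bijection from the blocks through `P` to the derived blocks, and a derived
-- block contains `T` iff its original contains `T ∪ ⁅ P ⁆`.
derived-isDesign : ∀ {t v k} {I : IncidenceStructure u} {P} →
  IsDesign (suc t) (v + 1) (k + 1) 1 I → P ∈ points I → IsDesign t v k 1 (derived I P)
derived-isDesign {t = t} {v} {k} {I} {P} design P∈I = record
  { isBlockSystem = record
    { numPoints = reduce (points I) P∈I numPoints
    ; blocksUnique = derivedUnique
    ; blocks⊆points = All.tabulate λ L∈ → let C , C∈I , P∈C , L≡C-P = ∈derived⁻ I L∈ in
        subst (_⊆ points I - P) (sym L≡C-P) (p⊆q⇒p-x⊆q-x (All.lookup blocks⊆points C∈I))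
    ; blockSize = All.tabulate λ L∈ → let C , C∈I , P∈C , L≡C-P = ∈derived⁻ I L∈ in
        trans (cong ∣_∣ L≡C-P) (reduce C P∈C (All.lookup blockSize C∈I))
    }
  ; exactly = through
  }
  where
  open IsDesign design
  open IsBlockSystem isBlockSystem

  reduce : ∀ {m} p → P ∈ p → ∣ p ∣ ≡ m + 1 → ∣ p - P ∣ ≡ m
  reduce {m} p P∈p ∣p∣≡m+1 = suc-injective (trans (sym (∣p∣≡1+∣p-x∣ p P∈p)) (trans ∣p∣≡m+1 (+-comm m 1)))

  derivedUnique : Unique (blocks (derived I P))
  derivedUnique = Unique-map
    (λ C∈ K∈ → p-x≡q-x⇒p≡q (proj₂ (∈-filter⁻ (P ∈?_) {xs = blocks I} C∈)) (proj₂ (∈-filter⁻ (P ∈?_) {xs = blocks I} K∈)))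
    (Unique.filter⁺ (P ∈?_) blocksUnique)

  through : ∀ T → T ⊆ points (derived I P) → ∣ T ∣ ≡ t → numBlocksThrough T (blocks (derived I P)) ≡ 1
  through T T⊆ ∣T∣≡t =
    let C , C∈I , T∪P⊆C , only = length-filter≡1⁻ ((T ∪ ⁅ P ⁆) ⊆?_)
          (exactly (T ∪ ⁅ P ⁆)
            (p⊆q⇒p∪x⊆q (λ x∈T → x∈p-y⇒x∈p (points I) P (T⊆ x∈T)) P∈I)
            (trans (∣p∪x∣≡1+∣p∣ T P∉T) (cong suc ∣T∣≡t)))
        P∈C = T∪P⊆C (x∈p∪⁅x⁆ T P)
    in length-filter≡1⁺ (T ⊆?_) derivedUnique (∈derived⁺ I C∈I P∈C)
      (λ x∈T → x∈p∧x≢y⇒x∈p-y (T∪P⊆C (p⊆p∪q ⁅ P ⁆ x∈T)) λ where refl → P∉T x∈T)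
      (λ L∈ T⊆L → let K , K∈I , P∈K , L≡K-P = ∈derived⁻ I L∈ in
        trans L≡K-P (cong (_- P)
          (only K∈I (p⊆q⇒p∪x⊆q (λ x∈T → x∈p-y⇒x∈p K P (subst (_ ∈_) L≡K-P (T⊆L x∈T))) P∈K))))
    where
    P∉T : P ∉ T
    P∉T P∈T = x∈p-y⇒x≢y (points I) P (T⊆ P∈T) refl

-- Needed for uniqueness: every completion of `I` induces at `P` an extension of the derived
-- structure, and there is only one of these.
derived-isCompletion : ∀ {t v k} {I D : IncidenceStructure u} {P} →
  IsCompletion (suc t) (v + 1) (k + 1) 1 I D → P ∈ points I →
  IsCompletion t v k 1 (derived I P) (derived D P)
derived-isCompletion {I = I} {D} {P} completion P∈I = record
  { isDesign = derived-isDesign isDesign (subst (P ∈_) (sym samePoints) P∈I)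
  ; samePoints = cong (_- P) samePoints
  ; blocks⊆ = λ L∈ → let C , C∈I , P∈C , L≡C-P = ∈derived⁻ I L∈ in
      subst (_∈ˡ blocks (derived D P)) (sym L≡C-P) (∈derived⁺ D (blocks⊆ C∈I) P∈C)
  }
  where open IsCompletion completion

-- Added lines, uncovered triples and the change of base point.

module Extension {u n v} (2≤n : 2 ≤ n) (I : IncidenceStructure u)
  (circles : IsBlockSystem (v + 1) (n + 1) I) (D : Fin u → IncidenceStructure u)
  (uniqueCompletion : ∀ {P} → P ∈ points I → IsUniqueCompletion 2 v n 1 (derived I P) (D P))
  (condition : ∀ {P} → P ∈ points I →
    ManySimpleFewAdded n (derived I P) (D P) ⊎ AtMostOneMultiplyAdded (derived I P) (D P)) where

  module At {P} (P∈I : P ∈ points I) where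
    open IsUniqueCompletion (uniqueCompletion P∈I) public
    open IsCompletion isCompletion public
    open Design isDesign public

    ∈points : ∀ {x} → x ∈ points I → x ≢ P → x ∈ points (D P)
    ∈points x∈I x≢P = subst (_ ∈_) (sym samePoints) (x∈p∧x≢y⇒x∈p-y x∈I x≢P)

    ∈points⁻ : ∀ {x} → x ∈ points (D P) → x ∈ points I × x ≢ P
    ∈points⁻ x∈D = let x∈ = subst (_ ∈_) samePoints x∈D in x∈p-y⇒x∈p (points I) P x∈ , x∈p-y⇒x≢y (points I) P x∈

    ∈line⇒∈points : ∀ {L x} → L ∈ˡ blocks (D P) → x ∈ L → x ∈ points I × x ≢ P
    ∈line⇒∈points L∈D x∈L = ∈points⁻ (line⊆points L∈D x∈L)

    P∉line : ∀ {L} → L ∈ˡ blocks (D P) → P ∉ L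
    P∉line L∈D P∈L = proj₂ (∈line⇒∈points L∈D P∈L) refl

  -- The memberships are separate arguments, so permuting the triple, and with it passing from `D P`
  -- to `D Q`, only reorders arguments.
  Uncovered : Fin u → Fin u → Fin u → Set
  Uncovered P Q X = ∀ {C} → C ∈ˡ blocks I → P ∈ C → Q ∈ C → ¬ X ∈ C

  added : Fin u → List (Subset u)
  added P = addedLines (derived I P) (D P)

  added? : ∀ P → Decidable (λ L → ¬ L ∈ˡ blocks (derived I P))
  added? P L = ¬? (DecMembership._∈?_ _≟ˢ_ L (blocks (derived I P)))

  added⁻ : ∀ {P L} → L ∈ˡ added P → L ∈ˡ blocks (D P) × ¬ L ∈ˡ blocks (derived I P)
  added⁻ {P} = ∈-filter⁻ (added? P)

  -- A circle `C` through `P`, `y` and `z` would give the line `C - P` of `D P`, which shares two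
  -- points with `L`. Then `L` would equal it and not be added.
  added⇒Uncovered : ∀ {P L y z} → P ∈ points I → L ∈ˡ added P → y ∈ L → z ∈ L → y ≢ z → Uncovered P y z
  added⇒Uncovered {P} {L} P∈I L∈ y∈L z∈L y≢z {C} C∈I P∈C y∈C z∈C =
    L∉I (subst (_∈ˡ blocks (derived I P))
      (line-unique (blocks⊆ C-P∈) L∈D y≢z (∈C-P y∈C y∈L) (∈C-P z∈C z∈L) y∈L z∈L)
      C-P∈)
    where
    open At P∈I
    L∈D = proj₁ (added⁻ L∈)
    L∉I = proj₂ (added⁻ L∈)
    C-P∈ = ∈derived⁺ I C∈I P∈C
    ∈C-P : ∀ {x} → x ∈ C → x ∈ L → x ∈ C - P
    ∈C-P x∈C x∈L = x∈p∧x≢y⇒x∈p-y x∈C (proj₂ (∈line⇒∈points L∈D x∈L))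

  Uncovered⇒added : ∀ {P L y z} → L ∈ˡ blocks (D P) → y ∈ L → z ∈ L → Uncovered P y z → L ∈ˡ added P
  Uncovered⇒added {P} {L} L∈D y∈L z∈L unc = ∈-filter⁺ (added? P) L∈D not-derived
    where
    not-derived : ¬ L ∈ˡ blocks (derived I P)
    not-derived L∈ with C , C∈I , P∈C , refl ← ∈derived⁻ I L∈ =
      unc C∈I P∈C (x∈p-y⇒x∈p C P y∈L) (x∈p-y⇒x∈p C P z∈L)

  line-through-Uncovered : ∀ {P y z} → P ∈ points I → y ≢ z → y ∈ points I → y ≢ P → z ∈ points I → z ≢ P →
    Uncovered P y z → ∃ λ L → L ∈ˡ added P × y ∈ L × z ∈ L
  line-through-Uncovered P∈I y≢z y∈I y≢P z∈I z≢P unc =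
    let open At P∈I
        L , L∈D , y∈L , z∈L = line-through y≢z (∈points y∈I y≢P) (∈points z∈I z≢P)
    in L , Uncovered⇒added L∈D y∈L z∈L unc , y∈L , z∈L

  module Switch {P Q L} (P∈I : P ∈ points I) (L∈D : L ∈ˡ blocks (D P)) (Q∈L : Q ∈ L) where
    open At P∈I using (∈line⇒∈points; P∉line)

    Q∈I : Q ∈ points I
    Q∈I = proj₁ (∈line⇒∈points L∈D Q∈L)

    Q≢P : Q ≢ P
    Q≢P = proj₂ (∈line⇒∈points L∈D Q∈L)

    -- The circle `L ∪ ⁅ P ⁆` as seen from `Q`: the line that `D Q` has to contain.
    C : Subset u
    C = (L ∪ ⁅ P ⁆) - Q

    P∈C : P ∈ C
    P∈C = x∈p∧x≢y⇒x∈p-y (x∈p∪⁅x⁆ L P) (≢-sym Q≢P)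

    ∈C⁺ : ∀ {x} → x ∈ L → x ≢ Q → x ∈ C
    ∈C⁺ x∈L = x∈p∧x≢y⇒x∈p-y (x∈p∪q⁺ (inj₁ x∈L))

    ∈C⁻ : ∀ {x} → x ∈ C → x ≢ Q × (x ∈ L ⊎ x ≡ P)
    ∈C⁻ {x} x∈C with x∈p∪q⁻ L ⁅ P ⁆ (x∈p-y⇒x∈p (L ∪ ⁅ P ⁆) Q x∈C)
    ... | inj₁ x∈L = x∈p-y⇒x≢y (L ∪ ⁅ P ⁆) Q x∈C , inj₁ x∈L
    ... | inj₂ x∈P = x∈p-y⇒x≢y (L ∪ ⁅ P ⁆) Q x∈C , inj₂ (x∈⁅y⁆⇒x≡y P x∈P)

    C⊆I : ∀ {x} → x ∈ C → x ∈ points I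
    C⊆I x∈C with ∈C⁻ x∈C
    ... | _ , inj₁ x∈L = proj₁ (∈line⇒∈points L∈D x∈L)
    ... | _ , inj₂ refl = P∈I

    C⊆D : ∀ {y} → y ∈ C → y ∈ points (D Q)
    C⊆D y∈C = At.∈points Q∈I (C⊆I y∈C) (proj₁ (∈C⁻ y∈C))

    ∣C∣≡n : ∣ C ∣ ≡ n
    ∣C∣≡n = suc-injective (begin
      suc ∣ C ∣      ≡⟨ ∣p∣≡1+∣p-x∣ (L ∪ ⁅ P ⁆) (x∈p∪q⁺ (inj₁ Q∈L)) ⟨
      ∣ L ∪ ⁅ P ⁆ ∣  ≡⟨ ∣p∪x∣≡1+∣p∣ L (P∉line L∈D) ⟩
      suc ∣ L ∣      ≡⟨ cong suc (At.line-size P∈I L∈D) ⟩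
      suc n          ∎)
      where open ≡-Reasoning

    another-on-L : ∀ {y} → y ∈ L → ∃ λ x → x ∈ L × x ≢ y
    another-on-L = 1<∣p∣⇒another L (subst (2 ≤_) (sym (At.line-size P∈I L∈D)) 2≤n)

    -- Here `L` is `K - P` for a given circle `K`, so `C` is `K - Q`, a line of the derived
    -- structure at `Q`.
    C∈D-of-not-added : L ∈ˡ blocks (derived I P) → C ∈ˡ blocks (D Q)
    C∈D-of-not-added L∈ with K , K∈I , P∈K , refl ← ∈derived⁻ I L∈ =
      subst (λ K′ → (K′ - Q) ∈ˡ blocks (D Q)) (sym (p-x∪x≡p P∈K))
        (At.blocks⊆ Q∈I (∈derived⁺ I K∈I (x∈p-y⇒x∈p K P Q∈L)))

    module _ (L∈added : L ∈ˡ added P) where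

      Uncovered-on-L : ∀ {x} → x ∈ L → x ≢ Q → Uncovered Q P x
      Uncovered-on-L x∈L x≢Q K∈I Q∈K P∈K x∈K = added⇒Uncovered P∈I L∈added Q∈L x∈L (≢-sym x≢Q) K∈I P∈K Q∈K x∈K

      -- If L is the only added line of D P through Q, then the added line of D Q through P and
      -- some x ∈ L is contained in C, since an uncovered triple {P, Q, y} forces y ∈ L.
      C∈added-of-simple : numAddedThrough (derived I P) (D P) Q ≤ 1 → C ∈ˡ added Q
      C∈added-of-simple simple
        with x , x∈L , x≢Q ← another-on-L Q∈L
        with M , M∈added , P∈M , x∈M ← line-through-Uncovered Q∈I (λ where refl → P∉line L∈D x∈L) P∈I (≢-sym Q≢P)
                                         (proj₁ (∈line⇒∈points L∈D x∈L)) x≢Q (Uncovered-on-L x∈L x≢Q)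
        = subst (_∈ˡ added Q)
            (p⊆q∧∣q∣≤∣p∣⇒p≡q M⊆C (≤-reflexive (trans ∣C∣≡n (sym (At.line-size Q∈I (proj₁ (added⁻ M∈added)))))))
            M∈added
        where
        M⊆C : M ⊆ C
        M⊆C {y} y∈M with y Fin.≟ P
        ... | yes refl = P∈C
        ... | no y≢P
          with y∈I , y≢Q ← At.∈line⇒∈points Q∈I (proj₁ (added⁻ M∈added)) y∈M
          with K , K∈added , Q∈K , y∈K ← line-through-Uncovered P∈I (≢-sym y≢Q) Q∈I Q≢P y∈I y≢P
                 (λ K∈I P∈K Q∈K → added⇒Uncovered Q∈I M∈added P∈M y∈M (≢-sym y≢P) K∈I Q∈K P∈K)
          = ∈C⁺ (subst (y ∈_) (length-filter≤1⇒≡ (Q ∈?_) simple K∈added Q∈K L∈added Q∈L) y∈K) y≢Q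

  module _ {P Q L} (P∈I : P ∈ points I) (L∈added : L ∈ˡ added P) (Q∈L : Q ∈ L)
    (multiple : ¬ numAddedThrough (derived I P) (D P) Q ≤ 1) where

    private
      L∈D : L ∈ˡ blocks (D P)
      L∈D = proj₁ (added⁻ L∈added)

      S : Subset u
      S = simplePoints (derived I P) (D P)

      -- Adjoining `P` to the simple points of `L` makes the bound `n < ∣ R ∣ * ∣ R ∣` strict when
      -- only √n simple points are guaranteed.
      R : Subset u
      R = (L ∩ S) ∪ ⁅ P ⁆

    open Switch P∈I L∈D Q∈L
    open Lines (added Q) n 2≤n (λ M∈ → At.line-size Q∈I (proj₁ (added⁻ M∈)))
      (λ M∈ N∈ → At.line-unique Q∈I (proj₁ (added⁻ M∈)) (proj₁ (added⁻ N∈)))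

    ∈S⇒≢Q : ∀ {x} → x ∈ S → x ≢ Q
    ∈S⇒≢Q x∈S refl = multiple (≤-reflexive (∈simplePoints⁻ (derived I P) (D P) x∈S))

    R⊆C : R ⊆ C
    R⊆C = p⊆q⇒p∪x⊆q (λ x∈ → let x∈L , x∈S = x∈p∩q⁻ L S x∈ in ∈C⁺ x∈L (∈S⇒≢Q x∈S)) P∈C

    -- It suffices that the triple of `Q`, `y`, `x` is uncovered, since the line of `D Q` through
    -- `y` and `x` is then added.
    R-joined : ∀ {y x} → y ∈ R → x ∈ C → x ≢ y → Joined y x
    R-joined {y} {x} y∈R x∈C x≢y = line-through-Uncovered Q∈I (≢-sym x≢y)
      (C⊆I (R⊆C y∈R)) (proj₁ (∈C⁻ (R⊆C y∈R))) (C⊆I x∈C) (proj₁ (∈C⁻ x∈C)) Qyx-uncovered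
      where
      Qyx-uncovered : Uncovered Q y x
      Qyx-uncovered with x∈p∪q⁻ (L ∩ S) ⁅ P ⁆ y∈R
      -- For `y = P`, the points `Q` and `x` lie on the added line `L` of `D P`.
      Qyx-uncovered | inj₂ y∈P with refl ← x∈⁅y⁆⇒x≡y P y∈P with ∈C⁻ x∈C
      ... | x≢Q , inj₁ x∈L = Uncovered-on-L L∈added x∈L x≢Q
      ... | _ , inj₂ x≡P = contradiction x≡P x≢y
      -- For simple `y`, the switch from `P` to `y` is already known: `(L ∪ ⁅ P ⁆) - y` is an added
      -- line of `D y`, and it contains `Q` and `x`.
      Qyx-uncovered | inj₁ y∈ with y∈L , y∈S ← x∈p∩q⁻ L S y∈ =
        λ K∈I Q∈K y∈K x∈K →
          added⇒Uncovered (Switch.Q∈I P∈I L∈D y∈L)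
            (Switch.C∈added-of-simple P∈I L∈D y∈L L∈added (≤-reflexive (∈simplePoints⁻ (derived I P) (D P) y∈S)))
            (Switch.∈C⁺ P∈I L∈D y∈L Q∈L (≢-sym (∈S⇒≢Q y∈S)))
            (x∈p∧x≢y⇒x∈p-y (x∈p-y⇒x∈p (L ∪ ⁅ P ⁆) Q x∈C) x≢y)
            (≢-sym (proj₁ (∈C⁻ x∈C))) K∈I y∈K Q∈K x∈K

    ∣R∣≡1+∣L∩S∣ : ∣ R ∣ ≡ suc ∣ L ∩ S ∣
    ∣R∣≡1+∣L∩S∣ = ∣p∪x∣≡1+∣p∣ (L ∩ S) λ P∈ → At.P∉line P∈I L∈D (proj₁ (x∈p∩q⁻ L S P∈))

    -- The condition at `P` is used. In case (i), `L` has at least √n simple points and `P` is one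
    -- more. In case (ii), `Q` is the only multiple point, so all of `L - Q` is simple and `∣ R ∣`
    -- is at least `n`.
    n<∣R∣² : n < ∣ R ∣ * ∣ R ∣
    n<∣R∣² with condition P∈I
    ... | inj₁ manySimple = begin-strict
      n                              ≤⟨ All.lookup (ManySimpleFewAdded.manySimple manySimple) L∈added ⟩
      ∣ L ∩ S ∣ ^ 2                  ≡⟨ m^2≡m*m ∣ L ∩ S ∣ ⟩
      ∣ L ∩ S ∣ * ∣ L ∩ S ∣          <⟨ *-mono-< (n<1+n ∣ L ∩ S ∣) (n<1+n ∣ L ∩ S ∣) ⟩
      suc ∣ L ∩ S ∣ * suc ∣ L ∩ S ∣  ≡⟨ cong₂ _*_ ∣R∣≡1+∣L∩S∣ ∣R∣≡1+∣L∩S∣ ⟨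
      ∣ R ∣ * ∣ R ∣                  ∎
      where open ≤-Reasoning
    ... | inj₂ atMostOne = begin-strict
      n              ≡⟨ *-identityˡ n ⟨
      1 * n          <⟨ *-monoˡ-< n ⦃ >-nonZero (≤-trans (s≤s z≤n) 2≤n) ⦄ 2≤n ⟩
      n * n          ≤⟨ *-mono-≤ n≤∣R∣ n≤∣R∣ ⟩
      ∣ R ∣ * ∣ R ∣  ∎
      where
      open ≤-Reasoning
      L-Q⊆L∩S : L - Q ⊆ L ∩ S
      L-Q⊆L∩S {x} x∈ with x∈L ← x∈p-y⇒x∈p L Q x∈ with numAddedThrough (derived I P) (D P) x ≤? 1
      ... | yes x≤1 = x∈p∩q⁺ (x∈L , ∈simplePoints⁺ (derived I P) (D P) (At.line⊆points P∈I L∈D x∈L)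
        (≤-antisym x≤1 (∈⇒0<length (∈-filter⁺ (x ∈?_) L∈added x∈L))))
      ... | no x≰1 = contradiction
        (atMostOne x Q (At.line⊆points P∈I L∈D x∈L) (At.line⊆points P∈I L∈D Q∈L) (≰⇒> x≰1) (≰⇒> multiple))
        (x∈p-y⇒x≢y L Q x∈)
      n≤∣R∣ : n ≤ ∣ R ∣
      n≤∣R∣ = begin
        n              ≡⟨ At.line-size P∈I L∈D ⟨
        ∣ L ∣          ≡⟨ ∣p∣≡1+∣p-x∣ L Q∈L ⟩
        suc ∣ L - Q ∣  ≤⟨ s≤s (p⊆q⇒∣p∣≤∣q∣ L-Q⊆L∩S) ⟩
        suc ∣ L ∩ S ∣  ≡⟨ ∣R∣≡1+∣L∩S∣ ⟨
        ∣ R ∣          ∎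

    -- Now the condition at `Q` is used, which may be the other case than at `P`; only the size of
    -- `R` is carried over.
    C∈added-of-multiple : C ∈ˡ added Q
    C∈added-of-multiple with condition Q∈I
    -- With `s` the integer part of √n, degrees whose square is at most `n` are at most `s`, while
    -- `∣ R ∣` exceeds `s`.
    ... | inj₁ fewAdded with s , s²≤n , n<[1+s]² ← isqrt n =
      C∈A-of-bounded C R ∣C∣≡n R⊆C R-joined s s²≤n (m*m<n*n⇒m<n (≤-<-trans s²≤n n<∣R∣²)) λ {y} y∈C →
        ≤-pred (m*m<n*n⇒m<n (≤-<-trans
          (subst (_≤ n) (m^2≡m*m (degree y))
            (ManySimpleFewAdded.fewAdded fewAdded y (C⊆D y∈C)))
          n<[1+s]²))
    ... | inj₂ atMostOne =
      C∈A-of-few-multiple C R ∣C∣≡n R⊆C R-joined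
        (m*m<n*n⇒m<n (≤-trans 2≤n (<⇒≤ n<∣R∣²))) λ {y} {z} y∈C z∈C → atMostOne y z (C⊆D y∈C) (C⊆D z∈C)

  -- Compatibility of the extensions at `P` and `Q`. Either `L` comes from a given circle, or it is
  -- the only added line of `D P` through `Q`, or `Q` lies on several added lines.
  switch : ∀ {P Q L} → P ∈ points I → L ∈ˡ blocks (D P) → Q ∈ L → ((L ∪ ⁅ P ⁆) - Q) ∈ˡ blocks (D Q)
  switch {P} {Q} {L} P∈I L∈D Q∈L with DecMembership._∈?_ _≟ˢ_ L (blocks (derived I P))
  ... | yes L∈ = Switch.C∈D-of-not-added P∈I L∈D Q∈L L∈
  ... | no L∉ with L∈added ← ∈-filter⁺ (added? P) L∈D L∉ with numAddedThrough (derived I P) (D P) Q ≤? 1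
  ...   | yes simple = proj₁ (added⁻ (Switch.C∈added-of-simple P∈I L∈D Q∈L L∈added simple))
  ...   | no multiple = proj₁ (added⁻ (C∈added-of-multiple P∈I L∈added Q∈L multiple))

  -- The completed design and its uniqueness.

  completedCircles : List (Subset u)
  -- By `switch`, a circle arises once from each of its points, so repetitions have to be removed.
  completedCircles = deduplicate _≟ˢ_
    (concatMap (λ P → map (_∪ ⁅ P ⁆) (blocks (D P))) (filter (_∈? points I) (allFin u)))

  completed : IncidenceStructure u
  completed = mkIncidence (points I) completedCircles

  ∈completed⁺ : ∀ {P L} → P ∈ points I → L ∈ˡ blocks (D P) → (L ∪ ⁅ P ⁆) ∈ˡ completedCircles
  ∈completed⁺ {P} P∈I L∈D = ∈-deduplicate⁺ _≟ˢ_ (∈-concatMap⁺ _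
    (lose (∈-filter⁺ (_∈? points I) (∈-allFin P) P∈I) (∈-map⁺ (_∪ ⁅ P ⁆) L∈D)))

  ∈completed⁻ : ∀ {C} → C ∈ˡ completedCircles → ∃ λ P → ∃ λ L → P ∈ points I × L ∈ˡ blocks (D P) × C ≡ L ∪ ⁅ P ⁆
  ∈completed⁻ C∈ =
    let P , P∈ , C∈P = find (∈-concatMap⁻ _ (∈-deduplicate⁻ _≟ˢ_ _ C∈))
        L , L∈D , C≡L∪P = ∈-map⁻ (_∪ ⁅ P ⁆) C∈P
    in P , L , proj₂ (∈-filter⁻ (_∈? points I) {xs = allFin u} P∈) , L∈D , C≡L∪P

  -- If the circle was built at `Q`, removing `Q` recovers its line; otherwise `switch` moves it
  -- from `P` to `Q`. With `completed⁺`, the circles through a point `P` of `I` correspond exactly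
  -- to the lines of `D P`.
  completed-derived : ∀ {C Q} → C ∈ˡ completedCircles → Q ∈ C → (C - Q) ∈ˡ blocks (D Q)
  completed-derived {Q = Q} C∈ Q∈C with P , L , P∈I , L∈D , refl ← ∈completed⁻ C∈
    with x∈p∪q⁻ L ⁅ P ⁆ Q∈C
  ... | inj₁ Q∈L = switch P∈I L∈D Q∈L
  ... | inj₂ Q∈P with refl ← x∈⁅y⁆⇒x≡y P Q∈P =
    subst (_∈ˡ blocks (D P)) (sym (p∪x-x≡p (At.P∉line P∈I L∈D))) L∈D

  completed⁺ : ∀ {C P} → P ∈ points I → P ∈ C → (C - P) ∈ˡ blocks (D P) → C ∈ˡ completedCircles
  completed⁺ P∈I P∈C C-P∈D = subst (_∈ˡ completedCircles) (p-x∪x≡p P∈C) (∈completed⁺ P∈I C-P∈D)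

  circle-nonempty : ∀ {C : Subset u} → ∣ C ∣ ≡ n + 1 → Nonempty C
  circle-nonempty {C} ∣C∣≡n+1 = 0<∣p∣⇒Nonempty C (subst (0 <_) (sym ∣C∣≡n+1) (m≤n+m 1 n))

  completed-isDesign : IsDesign 3 (v + 1) (n + 1) 1 completed
  completed-isDesign = record
    { isBlockSystem = record
      { numPoints = IsBlockSystem.numPoints circles
      ; blocksUnique = completedUnique
      ; blocks⊆points = All.tabulate λ C∈ → inside-points (∈completed⁻ C∈)
      ; blockSize = All.tabulate λ C∈ → size (∈completed⁻ C∈)
      }
    ; exactly = through
    }
    where
    completedUnique : Unique completedCircles
    completedUnique = DecUnique.deduplicate-! _≟ˢ_ _

    inside-points : ∀ {C} → (∃ λ P → ∃ λ L → P ∈ points I × L ∈ˡ blocks (D P) × C ≡ L ∪ ⁅ P ⁆) → C ⊆ points I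
    inside-points (P , L , P∈I , L∈D , refl) =
      p⊆q⇒p∪x⊆q (λ x∈L → proj₁ (At.∈line⇒∈points P∈I L∈D x∈L)) P∈I

    size : ∀ {C} → (∃ λ P → ∃ λ L → P ∈ points I × L ∈ˡ blocks (D P) × C ≡ L ∪ ⁅ P ⁆) → ∣ C ∣ ≡ n + 1
    size (P , L , P∈I , L∈D , refl) = trans (∣p∪x∣≡1+∣p∣ L (At.P∉line P∈I L∈D))
      (trans (cong suc (At.line-size P∈I L∈D)) (+-comm 1 n))

    -- Any `P` in `T` will do: circles through `T` correspond to lines of `D P` through the pair
    -- `T - P`.
    through : ∀ T → T ⊆ points I → ∣ T ∣ ≡ 3 → numBlocksThrough T completedCircles ≡ 1
    through T T⊆I ∣T∣≡3
      with P , P∈T ← 0<∣p∣⇒Nonempty T (subst (0 <_) (sym ∣T∣≡3) (s≤s z≤n))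
      with P∈I ← T⊆I P∈T
      with L , L∈D , T-P⊆L , only ← length-filter≡1⁻ ((T - P) ⊆?_) (IsDesign.exactly (At.isDesign P∈I) (T - P)
             (λ x∈ → At.∈points P∈I (T⊆I (x∈p-y⇒x∈p T P x∈)) (x∈p-y⇒x≢y T P x∈))
             (suc-injective (trans (sym (∣p∣≡1+∣p-x∣ T P∈T)) ∣T∣≡3)))
      = length-filter≡1⁺ (T ⊆?_) completedUnique (∈completed⁺ P∈I L∈D)
          (p-x⊆q⇒p⊆q (x∈p∪⁅x⁆ L P) λ x∈ → p⊆p∪q ⁅ P ⁆ (T-P⊆L x∈))
          λ K∈ T⊆K → trans (sym (p-x∪x≡p (T⊆K P∈T)))
            (cong (_∪ ⁅ P ⁆) (only (completed-derived K∈ (T⊆K P∈T)) (p⊆q⇒p-x⊆q-x T⊆K)))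

  completed-isUniqueCompletion : IsUniqueCompletion 3 (v + 1) (n + 1) 1 I completed
  completed-isUniqueCompletion = record
    { isCompletion = record
      { isDesign = completed-isDesign
      ; samePoints = refl
      ; blocks⊆ = λ C∈I →
          let P , P∈C = circle-nonempty (All.lookup (IsBlockSystem.blockSize circles) C∈I)
              P∈I = All.lookup (IsBlockSystem.blocks⊆points circles) C∈I P∈C
          in completed⁺ P∈I P∈C (At.blocks⊆ P∈I (∈derived⁺ I C∈I P∈C))
      }
    ; unique = λ D′ completion → mk⇔ (to D′ completion) (from D′ completion)
    }
    where
    module _ (D′ : IncidenceStructure u) (completion : IsCompletion 3 (v + 1) (n + 1) 1 I D′) where
      open IsCompletion completion
      open IsBlockSystem (IsDesign.isBlockSystem isDesign)

      -- Uniqueness of `D P` determines the circles of `D′` through each point, hence all of them,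
      -- since every circle is nonempty.
      same-lines : ∀ {P} (P∈I : P ∈ points I) → blocks (derived D′ P) ∼[ set ] blocks (D P)
      same-lines P∈I = At.unique P∈I _ (derived-isCompletion completion P∈I)

      to : ∀ {C} → C ∈ˡ blocks D′ → C ∈ˡ completedCircles
      to C∈D′ =
        let P , P∈C = circle-nonempty (All.lookup blockSize C∈D′)
            P∈I = subst (P ∈_) samePoints (All.lookup blocks⊆points C∈D′ P∈C)
        in completed⁺ P∈I P∈C (Equivalence.to (same-lines P∈I) (∈derived⁺ D′ C∈D′ P∈C))

      from : ∀ {C} → C ∈ˡ completedCircles → C ∈ˡ blocks D′
      from C∈ with P , L , P∈I , L∈D , refl ← ∈completed⁻ C∈
        with C′ , C′∈D′ , P∈C′ , refl ← ∈derived⁻ D′ (Equivalence.from (same-lines P∈I) L∈D)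
        = subst (_∈ˡ blocks D′) (sym (p-x∪x≡p P∈C′)) C′∈D′

theorem8 : ∀ {u} (n d : ℕ) → 2 ≤ n → 2 ≤ d →
    (I : IncidenceStructure u) → IsPartialDesign 3 (n ^ d + 1) (n + 1) 1 I →
    (∀ P → P ∈ points I → ∃ λ D →
    IsUniqueCompletion 2 (n ^ d) n 1 (derived I P) D ×
    (ManySimpleFewAdded n (derived I P) D ⊎ AtMostOneMultiplyAdded (derived I P) D)) →
    ∃ λ D → IsUniqueCompletion 3 (n ^ d + 1) (n + 1) 1 I D
theorem8 {u} n d 2≤n 2≤d I partialDesign extend = completed , completed-isUniqueCompletion
  where
  -- The value I at the P outside of points I is arbitrary.
  D : Fin u → IncidenceStructure u
  D P with P ∈? points I
  ... | yes P∈I = proj₁ (extend P P∈I)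
  ... | no _ = I

  extended : ∀ {P} → P ∈ points I → IsUniqueCompletion 2 (n ^ d) n 1 (derived I P) (D P) ×
    (ManySimpleFewAdded n (derived I P) (D P) ⊎ AtMostOneMultiplyAdded (derived I P) (D P))
  extended {P} P∈I with P ∈? points I
  ... | yes P∈I′ = proj₂ (extend P P∈I′)
  ... | no P∉I = contradiction P∈I P∉I

  open Extension 2≤n I (IsPartialDesign.isBlockSystem partialDesign) D
    (λ P∈I → proj₁ (extended P∈I)) (λ P∈I → proj₂ (extended P∈I))
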